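{- Let $n,k\in\mathbb{N}$ with $n\ge 3k-1$. If for all $t$ with $2\le t\le k$ the inequality \[ k^t\binom{n-t}{k-t}+t\le \binom{n-1}{k-1} \] holds, then \[ \mathrm{gp}(K(n,k))=\binom{n-1}{k-1}, \] where $K(n,k)$ is the Kneser graph.
   Context: Graphs are finite, undirected and simple. For positive integers $n\ge k$, the Kneser graph $K(n,k)$ has as vertices all $k$-element subsets of $[n]=\{1,\ldots,n\}$, two vertices being adjacent if the corresponding sets are disjoint. For a graph $G$, $d_G$ is the shortest-path distance; a $u,v$-geodesic is a $u,v$-path of length $d_G(u,v)$. A set $S\subseteq V(G)$ is a general position set of $G$ if no vertex of $S$ lies on a geodesic between two other vertices of $S$. The general position number $\mathrm{gp}(G)$ is the maximum cardinality of a general position set of $G$.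
   Formalization: The formal theorem adds k ≥ 2; for k = 1 the condition on t is vacuous and the claim fails, since K(n,1) is the complete graph with gp = n ≥ 2, while the binomial coefficient is 1. -}

module Defs where

open import Data.Nat using (ℕ; zero; suc; _≤_; NonZero; ≢-nonZero⁻¹)
open import Data.Nat.Properties using (≤-antisym; ≡-irrelevant; suc-injective)
open import Data.Fin.Subset using (Subset; inside; outside; ∣_∣; _∩_; Empty)
open import Data.Fin.Subset.Properties using (Empty-unique; ∣⊥∣≡0; ∩-idem; ∩-comm)
open import Data.List using (List; []; _∷_; _++_; map; length)
open import Data.List.Membership.Propositional using (_∈_; _∉_)
open import Data.List.Membership.Propositional.Properties using (∈-map⁺; ∈-++⁺ˡ; ∈-++⁺ʳ)
open import Data.List.Relation.Unary.Any using (here)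
open import Data.List.Relation.Unary.Enumerates.Setoid using (IsEnumeration)
open import Data.List.Relation.Unary.Unique.Propositional using (Unique)
open import Data.Product using (Σ; ∃-syntax; _×_; _,_; proj₁)
open import Data.Vec using ([]; _∷_)
open import Relation.Binary.Construct.Closure.ReflexiveTransitive using (Star; ε; _◅_)
open import Relation.Binary.Definitions using (Symmetric; Irreflexive)
open import Relation.Binary.PropositionalEquality
  using (_≡_; _≢_; refl; sym; trans; cong; subst; setoid)

record Graph : Set₁ where
  field
    Vertex      : Set
    Adj         : Vertex → Vertex → Set
    symmetric   : Symmetric Adj
    irreflexive : Irreflexive _≡_ Adj
    enumeration : List Vertex
    finite      : IsEnumeration (setoid Vertex) enumeration

module _ (G : Graph) where
  open Graph G

  Walk : Vertex → Vertex → Set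
  Walk = Star Adj

  walkLength : ∀ {u v} → Walk u v → ℕ
  walkLength ε       = 0
  walkLength (_ ◅ p) = suc (walkLength p)

  walkVertices : ∀ {u v} → Walk u v → List Vertex
  walkVertices {u} ε       = u ∷ []
  walkVertices {u} (_ ◅ p) = u ∷ walkVertices p

  IsPath : ∀ {u v} → Walk u v → Set
  IsPath p = Unique (walkVertices p)

  -- A relation rather than a function, as vertices in different components
  -- have no distance.
  IsDistance : Vertex → Vertex → ℕ → Set
  IsDistance u v d =
      (∃[ p ] IsPath {u} {v} p × walkLength p ≡ d)
    × (∀ (p : Walk u v) → IsPath p → d ≤ walkLength p)

  IsGeodesic : ∀ {u v} → Walk u v → Set
  IsGeodesic {u} {v} p = IsPath p × IsDistance u v (walkLength p)

  -- Finite vertex sets are represented by duplicate-free lists, so that their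
  -- cardinality is the length of the list.
  record IsGeneralPositionSet (S : List Vertex) : Set where
    field
      unique          : Unique S
      generalPosition :
        ∀ {u v w} → u ∈ S → v ∈ S → w ∈ S → u ≢ v → w ≢ u → w ≢ v →
        (p : Walk u v) → IsGeodesic p → w ∉ walkVertices p

  -- m = gp(G), i.e. m is the maximum cardinality of a general position set.
  IsGpNumber : ℕ → Set
  IsGpNumber m =
      (∃[ S ] IsGeneralPositionSet S × length S ≡ m)
    × (∀ S → IsGeneralPositionSet S → length S ≤ m)

  IsGpNumber-unique : ∀ {m m′} → IsGpNumber m → IsGpNumber m′ → m ≡ m′
  IsGpNumber-unique ((S , gp , refl) , max) ((S′ , gp′ , refl) , max′) =
    ≤-antisym (max′ S gp) (max S′ gp′)

KSubset : ℕ → ℕ → Set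
KSubset n k = Σ (Subset n) λ p → ∣ p ∣ ≡ k

private
  out : ∀ {n k} → KSubset n k → KSubset (suc n) k
  out (p , e) = outside ∷ p , e

  into : ∀ {n k} → KSubset n k → KSubset (suc n) (suc k)
  into (p , e) = inside ∷ p , cong suc e

kSubsets : ∀ n k → List (KSubset n k)
kSubsets zero    zero    = ([] , refl) ∷ []
kSubsets zero    (suc k) = []
kSubsets (suc n) zero    = map out (kSubsets n zero)
kSubsets (suc n) (suc k) = map into (kSubsets n k) ++ map out (kSubsets n (suc k))

kSubsets-complete : ∀ n k → IsEnumeration (setoid (KSubset n k)) (kSubsets n k)
kSubsets-complete zero    zero    ([] , refl)        = here refl
kSubsets-complete (suc n) zero    (outside ∷ p , e)  =
  ∈-map⁺ out (kSubsets-complete n zero (p , e))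
kSubsets-complete (suc n) (suc k) (outside ∷ p , e)  =
  ∈-++⁺ʳ (map into (kSubsets n k)) (∈-map⁺ out (kSubsets-complete n (suc k) (p , e)))
kSubsets-complete (suc n) (suc k) (inside ∷ p , e)   =
  subst (λ e′ → (inside ∷ p , e′) ∈ kSubsets (suc n) (suc k))
        (≡-irrelevant (cong suc (suc-injective e)) e)
        (∈-++⁺ˡ (∈-map⁺ into (kSubsets-complete n k (p , suc-injective e))))

Disjoint : ∀ {n} → Subset n → Subset n → Set
Disjoint p q = Empty (p ∩ q)

-- k must be positive: the empty set is disjoint from itself.
Kneser : ∀ n k → .{{_ : NonZero k}} → Graph
Kneser n k = record
  { Vertex      = KSubset n k
  ; Adj         = λ a b → Disjoint (proj₁ a) (proj₁ b)
  ; symmetric   = λ {a} {b} → subst Empty (∩-comm (proj₁ a) (proj₁ b))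
  ; irreflexive = λ { {p , ∣p∣≡k} refl disj → ≢-nonZero⁻¹ k (trans (sym ∣p∣≡k)
      (trans (cong ∣_∣ (Empty-unique (subst Empty (∩-idem p) disj))) (∣⊥∣≡0 n))) }
  ; enumeration = kSubsets n k
  ; finite      = kSubsets-complete n k
  }

-- For n ≥ 3k − 1 the Kneser graph has diameter 2, so S is a general position set iff its
-- induced subgraph is a disjoint union of cliques; the sets through a fixed point form an
-- independent such S. Conversely, if some component T of S has t ≥ 2 members, every other
-- member of S meets each of these t pairwise disjoint k-sets, hence contains one of their k^t
-- transversals: |S| ≤ k^t C(n−t, k−t) + t when t ≤ k, while for t > k there is no other member
-- and t ≤ n/k. If all components are singletons, S is intersecting: either it has a common
-- point, or the same kind of count gives |S| ≤ k² C(n−2, k−2).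

module Submission where

open import Defs
open import Data.Bool.Properties using () renaming (_≟_ to _≟ᵇ_)
open import Data.Fin using (Fin; zero; suc)
import Data.Fin.Properties as Fin
open import Data.Fin.Subset
  using (Subset; inside; outside; _∈_; _∉_; _⊆_; _∩_; _∪_; ∁; ⊥; ⊤; ⁅_⁆; ∣_∣; Nonempty)
open import Data.Fin.Subset.Properties
open import Data.List using (List; []; _∷_; length; map; filter)
open import Data.List.Membership.Propositional using (find) renaming (_∈_ to _∈ˡ_; _∉_ to _∉ˡ_)
open import Data.List.Membership.Propositional.Properties using (∈-filter⁺; ∈-filter⁻; ∈-map⁻)
open import Data.List.Properties using (length-map; length-++)
open import Data.List.Relation.Unary.All as All using (All; []; _∷_)
import Data.List.Relation.Unary.All.Properties as All
open import Data.List.Relation.Unary.AllPairs using (AllPairs; []; _∷_)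
open import Data.List.Relation.Unary.Any as Any using (here; there)
open import Data.List.Relation.Unary.Unique.Propositional using (Unique)
import Data.List.Relation.Unary.Unique.Propositional.Properties as Unique
open import Data.Nat using (ℕ; zero; suc; _+_; _*_; _∸_; _^_; _≤_; _<_; _≥_; z≤n; s≤s; NonZero)
open import Data.Nat.Combinatorics using (_C_; nC1≡n; nCn≡1; nCk+nC[k+1]≡[n+1]C[k+1])
open import Data.Nat.Properties hiding (_≟_)
open import Data.Product using (∃; _×_; _,_; proj₁; proj₂)
open import Data.Sum using (_⊎_; inj₁; inj₂)
open import Data.Vec using ([]; _∷_; here; there; head; tail)
open import Data.Vec.Properties using (≡-dec)
open import Function using (_∘_)
open import Relation.Binary.Construct.Closure.ReflexiveTransitive using (ε; _◅_)
open import Relation.Binary.PropositionalEquality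
  using (_≡_; _≢_; refl; sym; trans; cong; cong₂; subst; ≢-sym)
open import Relation.Nullary using (Dec; yes; no; ¬_; ¬?; contradiction)
open import Relation.Nullary.Decidable using (decidable-stable; _⊎-dec_)
open import Relation.Unary using (Decidable)

-- Bounds on the number of elements satisfying a predicate

-- Quantifying over duplicate-free lists bounds a cardinality without enumerating `A`, and the bound
-- applies at once to any family given as a list.
AtMost : {A : Set} → ℕ → (A → Set) → Set
AtMost b P = ∀ L → Unique L → All P L → length L ≤ b

module _ {A : Set} where

  length-filter-∁ : {P : A → Set} (P? : Decidable P) (L : List A) →
                    length L ≡ length (filter P? L) + length (filter (¬? ∘ P?) L)
  length-filter-∁ P? []       = refl
  length-filter-∁ P? (x ∷ xs) with P? x
  ... | yes _ = cong suc (length-filter-∁ P? xs)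
  ... | no  _ = trans (cong suc (length-filter-∁ P? xs)) (sym (+-suc _ _))

  atMost-⊆ : {P Q : A → Set} {b : ℕ} → (∀ {x} → P x → Q x) → AtMost b Q → AtMost b P
  atMost-⊆ P⊆Q bound L uniq all = bound L uniq (All.map P⊆Q all)

  atMost-≡ : {P : A → Set} {a b : ℕ} → a ≡ b → AtMost a P → AtMost b P
  atMost-≡ refl bound = bound

  atMost-split : {P D : A → Set} {a b : ℕ} → Decidable D →
                 AtMost a (λ x → P x × D x) → AtMost b (λ x → P x × ¬ D x) →
                 AtMost (a + b) P
  atMost-split D? boundᵈ bound¬ᵈ L uniq all =
    ≤-trans (≤-reflexive (length-filter-∁ D? L))
      (+-mono-≤
        (boundᵈ _ (Unique.filter⁺ D? uniq)
          (All.zip (All.filter⁺ D? all , All.all-filter D? L)))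
        (bound¬ᵈ _ (Unique.filter⁺ (¬? ∘ D?) uniq)
          (All.zip (All.filter⁺ (¬? ∘ D?) all , All.all-filter (¬? ∘ D?) L))))

  -- Injectivity is asked for only on `P`: the map used below is `tail`, which is injective on
  -- subsets only once the first coordinate is fixed.
  atMost-injection : {B : Set} {P : A → Set} {Q : B → Set} {b : ℕ} (f : A → B) →
                     (∀ {x} → P x → Q (f x)) →
                     (∀ {x y} → P x → P y → f x ≡ f y → x ≡ y) →
                     AtMost b Q → AtMost b P
  atMost-injection {P = P} {b = b} f P⇒Q inj bound L uniq all =
    subst (_≤ b) (length-map f L)
      (bound (map f L) (unique-map uniq all) (All.map⁺ (All.map P⇒Q all)))
    where
    unique-map : ∀ {xs} → Unique xs → All P xs → Unique (map f xs)
    unique-map []          []         = []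
    unique-map (x∉ ∷ uniq) (px ∷ pxs) =
      All.map⁺ (All.zipWith (λ (x≢y , py) → x≢y ∘ inj px py) (x∉ , pxs)) ∷ unique-map uniq pxs

  -- Union bound over the members of `p`: the elements with `D` at the first member are split off,
  -- and what remains is charged to the later members.
  atMost-∃ : ∀ {n b} {P : A → Set} {D : Fin n → A → Set} → (∀ i → Decidable (D i)) →
             (p : Subset n) → (∀ i → i ∈ p → AtMost b (λ x → P x × D i x)) →
             AtMost (∣ p ∣ * b) (λ x → P x × ∃ λ i → i ∈ p × D i x)
  atMost-∃ D? [] bound []      _ _                       = z≤n
  atMost-∃ D? [] bound (_ ∷ _) _ ((_ , () , _) ∷ _)
  atMost-∃ D? (outside ∷ p) bound =
    atMost-⊆ (λ { (px , suc i , there i∈p , d) → px , i , i∈p , d })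
      (atMost-∃ (D? ∘ suc) p (λ i → bound (suc i) ∘ there))
  atMost-∃ D? (inside ∷ p) bound =
    atMost-split (D? zero)
      (atMost-⊆ (λ ((px , _) , d) → px , d) (bound zero here))
      (atMost-⊆ (λ { ((px , zero , _ , d) , ¬d)            → contradiction d ¬d
                   ; ((px , suc i , there i∈p , d) , ¬d) → px , i , i∈p , d })
        (atMost-∃ (D? ∘ suc) p (λ i → bound (suc i) ∘ there)))

-- Counting sets that meet or contain a given set

private
  variable
    n k : ℕ

atMost-meets : ∀ {b} {P : Subset n → Set} (p : Subset n) →
               (∀ x → x ∈ p → AtMost b (λ q → P q × x ∈ q)) →
               AtMost (∣ p ∣ * b) (λ q → P q × Nonempty (p ∩ q))
atMost-meets p bound =
  atMost-⊆ (λ {q} (Pq , x , x∈p∩q) → Pq , x , x∈p∩q⁻ p q x∈p∩q) (atMost-∃ _∈?_ p bound)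

-- A superset with `j` extra points is a choice of `j` points of the complement. A point of `p` is
-- forced, and a point outside `p` is either taken or not, which is Pascal's rule.
atMost-⊇ : ∀ j (p : Subset n) → AtMost (∣ ∁ p ∣ C j) (λ q → p ⊆ q × ∣ q ∣ ≡ ∣ p ∣ + j)
atMost-⊇ zero [] []      _    _ = z≤n
atMost-⊇ zero [] (_ ∷ []) _    _ = s≤s z≤n
atMost-⊇ zero [] ([] ∷ [] ∷ _) ((x≢y ∷ _) ∷ _) _ = contradiction refl x≢y
atMost-⊇ (suc j) [] []      _    _ = z≤n
atMost-⊇ (suc j) [] ([] ∷ _) _    ((_ , ()) ∷ _)
atMost-⊇ j (inside ∷ p) =
  atMost-injection tail
    (λ { {inside ∷ q} (p⊆q , ∣q∣) → drop-∷-⊆ p⊆q , suc-injective ∣q∣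
       ; {outside ∷ q} (p⊆q , _) → contradiction (p⊆q here) λ () })
    (λ { {inside ∷ q} {inside ∷ r} _ _ refl → refl
       ; {outside ∷ q} (p⊆q , _) _ _ → contradiction (p⊆q here) λ ()
       ; {_} {outside ∷ r} _ (p⊆r , _) _ → contradiction (p⊆r here) λ () })
    (atMost-⊇ j p)
-- With no extra points to place, taking this point would make the superset too large, so only one
-- branch survives.
atMost-⊇ zero (outside ∷ p) =
  atMost-injection tail
    (λ { {inside ∷ q} h → contradiction h too-large
       ; {outside ∷ q} (p⊆q , ∣q∣) → drop-∷-⊆ p⊆q , ∣q∣ })
    (λ { {outside ∷ q} {outside ∷ r} _ _ refl → refl
       ; {inside ∷ q} h → contradiction h too-large
       ; {_} {inside ∷ r} _ h → contradiction h too-large })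
    (atMost-⊇ zero p)
  where
  too-large : ∀ {q} → ¬ (outside ∷ p ⊆ inside ∷ q × suc ∣ q ∣ ≡ ∣ p ∣ + 0)
  too-large (p⊆q , ∣q∣) =
    <-irrefl (sym (trans ∣q∣ (+-identityʳ ∣ p ∣))) (s≤s (p⊆q⇒∣p∣≤∣q∣ (drop-∷-⊆ p⊆q)))
atMost-⊇ (suc j) (outside ∷ p) =
  atMost-≡ (nCk+nC[k+1]≡[n+1]C[k+1] ∣ ∁ p ∣ j)
    (atMost-split (zero ∈?_)
      (atMost-injection tail
        (λ { {inside ∷ q} ((p⊆q , ∣q∣) , _) →
               drop-∷-⊆ p⊆q , suc-injective (trans ∣q∣ (+-suc ∣ p ∣ j))
           ; {outside ∷ q} (_ , ()) })
        (λ { {inside ∷ q} {inside ∷ r} _ _ refl → refl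
           ; {outside ∷ q} (_ , ())
           ; {_} {outside ∷ r} _ (_ , ()) })
        (atMost-⊇ j p))
      (atMost-injection tail
        (λ { {inside ∷ q} (_ , 0∉q) → contradiction here 0∉q
           ; {outside ∷ q} ((p⊆q , ∣q∣) , _) → drop-∷-⊆ p⊆q , ∣q∣ })
        (λ { {outside ∷ q} {outside ∷ r} _ _ refl → refl
           ; {inside ∷ q} (_ , 0∉q) → contradiction here 0∉q
           ; {_} {inside ∷ r} _ (_ , 0∉r) → contradiction here 0∉r })
        (atMost-⊇ (suc j) p)))

atMost-kSubsets-⊇ : ∀ {t} (p : Subset n) → ∣ p ∣ ≡ t → t ≤ k →
                    AtMost ((n ∸ t) C (k ∸ t)) (λ q → ∣ q ∣ ≡ k × p ⊆ q)
atMost-kSubsets-⊇ {n} {k} p refl t≤k =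
  atMost-≡ (cong (_C (k ∸ ∣ p ∣)) (∣∁p∣≡n∸∣p∣ p))
    (atMost-⊆ (λ (∣q∣ , p⊆q) → p⊆q , trans ∣q∣ (sym (m+[n∸m]≡n t≤k)))
      (atMost-⊇ (k ∸ ∣ p ∣) p))

-- Disjoint subsets

disjoint? : (p q : Subset n) → Dec (Disjoint p q)
disjoint? p q = ¬? (nonempty? (p ∩ q))

disjoint-sym : {p q : Subset n} → Disjoint p q → Disjoint q p
disjoint-sym {p = p} {q} disj = subst (¬_ ∘ Nonempty) (∩-comm p q) disj

∣⁅x⁆∪p∣ : ∀ x (p : Subset n) → x ∉ p → ∣ ⁅ x ⁆ ∪ p ∣ ≡ suc ∣ p ∣
∣⁅x⁆∪p∣ zero    (inside  ∷ p) x∉p = contradiction here x∉p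
∣⁅x⁆∪p∣ zero    (outside ∷ p) _   = cong (suc ∘ ∣_∣) (∪-identityˡ p)
∣⁅x⁆∪p∣ (suc x) (inside  ∷ p) x∉p = cong suc (∣⁅x⁆∪p∣ x p (x∉p ∘ there))
∣⁅x⁆∪p∣ (suc x) (outside ∷ p) x∉p = ∣⁅x⁆∪p∣ x p (x∉p ∘ there)

⁅x⁆∪p⊆q : ∀ {x} {p q : Subset n} → x ∈ q → p ⊆ q → ⁅ x ⁆ ∪ p ⊆ q
⁅x⁆∪p⊆q {x = x} {p} x∈q p⊆q y∈ with x∈p∪q⁻ ⁅ x ⁆ p y∈
... | inj₁ y∈⁅x⁆ rewrite x∈⁅y⁆⇒x≡y x y∈⁅x⁆ = x∈q
... | inj₂ y∈p = p⊆q y∈p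

⁅x⁆⊆p : ∀ {x} {p : Subset n} → x ∈ p → ⁅ x ⁆ ⊆ p
⁅x⁆⊆p {x = x} x∈p y∈ rewrite x∈⁅y⁆⇒x≡y x y∈ = x∈p

∣p∪q∣≤∣p∣+∣q∣ : (p q : Subset n) → ∣ p ∪ q ∣ ≤ ∣ p ∣ + ∣ q ∣
∣p∪q∣≤∣p∣+∣q∣ []            []            = z≤n
∣p∪q∣≤∣p∣+∣q∣ (outside ∷ p) (outside ∷ q) = ∣p∪q∣≤∣p∣+∣q∣ p q
∣p∪q∣≤∣p∣+∣q∣ (outside ∷ p) (inside  ∷ q) =
  ≤-trans (s≤s (∣p∪q∣≤∣p∣+∣q∣ p q)) (≤-reflexive (sym (+-suc ∣ p ∣ ∣ q ∣)))
∣p∪q∣≤∣p∣+∣q∣ (inside  ∷ p) (outside ∷ q) = s≤s (∣p∪q∣≤∣p∣+∣q∣ p q)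
∣p∪q∣≤∣p∣+∣q∣ (inside  ∷ p) (inside  ∷ q) =
  s≤s (≤-trans (∣p∪q∣≤∣p∣+∣q∣ p q) (+-monoʳ-≤ ∣ p ∣ (n≤1+n ∣ q ∣)))

∣p∩q∣+∣∁p∩q∣≡∣q∣ : (p q : Subset n) → ∣ p ∩ q ∣ + ∣ ∁ p ∩ q ∣ ≡ ∣ q ∣
∣p∩q∣+∣∁p∩q∣≡∣q∣ []            []            = refl
∣p∩q∣+∣∁p∩q∣≡∣q∣ (outside ∷ p) (outside ∷ q) = ∣p∩q∣+∣∁p∩q∣≡∣q∣ p q
∣p∩q∣+∣∁p∩q∣≡∣q∣ (outside ∷ p) (inside  ∷ q) =
  trans (+-suc ∣ p ∩ q ∣ _) (cong suc (∣p∩q∣+∣∁p∩q∣≡∣q∣ p q))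
∣p∩q∣+∣∁p∩q∣≡∣q∣ (inside  ∷ p) (outside ∷ q) = ∣p∩q∣+∣∁p∩q∣≡∣q∣ p q
∣p∩q∣+∣∁p∩q∣≡∣q∣ (inside  ∷ p) (inside  ∷ q) = cong suc (∣p∩q∣+∣∁p∩q∣≡∣q∣ p q)

-- Remove the points of `p` from `q`: this costs at least `m` points, and the later sets, being
-- disjoint from `p`, keep their whole intersection with what is left of `q`.
length*m≤∣q∣ : ∀ {m} (T : List (Subset n)) (q : Subset n) → AllPairs Disjoint T →
          All (λ p → m ≤ ∣ p ∩ q ∣) T → length T * m ≤ ∣ q ∣
length*m≤∣q∣ []      q _ _ = z≤n
length*m≤∣q∣ {m = m} (p ∷ T) q (p-T ∷ disj) (m≤ ∷ m≤s) =
  ≤-trans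
    (+-mono-≤ m≤ (length*m≤∣q∣ T (∁ p ∩ q) disj
      (All.zipWith (λ (p-r , m≤r) → ≤-trans m≤r (p⊆q⇒∣p∣≤∣q∣ (avoid p-r))) (p-T , m≤s))))
    (≤-reflexive (∣p∩q∣+∣∁p∩q∣≡∣q∣ p q))
  where
  avoid : ∀ {r} → Disjoint p r → r ∩ q ⊆ r ∩ (∁ p ∩ q)
  avoid {r} p-r x∈ with x∈p∩q⁻ r q x∈
  ... | x∈r , x∈q = x∈p∩q⁺ (x∈r , x∈p∩q⁺ (x∉p⇒x∈∁p (λ x∈p → p-r (_ , x∈p∩q⁺ (x∈p , x∈r))) , x∈q))

-- Transversals of pairwise disjoint sets

Meets : List (Subset n) → Subset n → Set
Meets T q = All (λ p → Nonempty (p ∩ q)) T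

-- Branch over the `k` points `x` of the first set `r` that `q` may contain, and move `x` into `p`.
-- As `p` is disjoint from the sets still to be met, `x` is new, so `length T + ∣ p ∣` stays equal
-- to `t`; once `T` is exhausted, `q` contains `t` prescribed points.
atMost-transversal :
  ∀ {t} (T : List (Subset n)) (p : Subset n) →
  AllPairs Disjoint T → All (λ r → ∣ r ∣ ≡ k) T → All (Disjoint p) T →
  length T + ∣ p ∣ ≡ t → t ≤ k →
  AtMost (k ^ length T * ((n ∸ t) C (k ∸ t))) (λ q → (∣ q ∣ ≡ k × p ⊆ q) × Meets T q)
atMost-transversal [] p _ _ _ ∣p∣≡t t≤k =
  atMost-≡ (sym (+-identityʳ _)) (atMost-⊆ proj₁ (atMost-kSubsets-⊇ p ∣p∣≡t t≤k))
atMost-transversal {n} {k} {t} (r ∷ T) p (r-T ∷ disj) (∣r∣ ∷ ∣T∣) (p-r ∷ p-T) eq t≤k =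
  atMost-≡ arith
    (atMost-⊆ (λ { (h , r∩q ∷ meets) → (h , meets) , r∩q })
      (atMost-meets r λ x x∈r →
        atMost-⊆ (λ (((∣q∣ , p⊆q) , meets) , x∈q) → (∣q∣ , ⁅x⁆∪p⊆q x∈q p⊆q) , meets)
          (atMost-transversal T (⁅ x ⁆ ∪ p) disj ∣T∣
            (All.zipWith (λ (r-s , p-s) → insert-disjoint x∈r r-s p-s) (r-T , p-T))
            (trans (cong (length T +_) (∣⁅x⁆∪p∣ x p λ x∈p → p-r (x , x∈p∩q⁺ (x∈p , x∈r))))
              (trans (+-suc (length T) ∣ p ∣) eq))
            t≤k)))
  where
  c = (n ∸ t) C (k ∸ t)
  arith : ∣ r ∣ * (k ^ length T * c) ≡ k ^ suc (length T) * c
  arith = trans (cong (_* (k ^ length T * c)) ∣r∣) (sym (*-assoc k (k ^ length T) c))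
  insert-disjoint : ∀ {x s} → x ∈ r → Disjoint r s → Disjoint p s → Disjoint (⁅ x ⁆ ∪ p) s
  insert-disjoint {x} {s} x∈r r-s p-s (y , y∈) with x∈p∩q⁻ (⁅ x ⁆ ∪ p) s y∈
  ... | y∈∪ , y∈s with x∈p∪q⁻ ⁅ x ⁆ p y∈∪
  ... | inj₁ y∈⁅x⁆ rewrite x∈⁅y⁆⇒x≡y x y∈⁅x⁆ = r-s (x , x∈p∩q⁺ (x∈r , y∈s))
  ... | inj₂ y∈p = p-s (y , x∈p∩q⁺ (y∈p , y∈s))

-- Needed for cliques with more than `k` members. The gap is exactly one at `j = 1` and `j = m`; in
-- between, Pascal's rule adds a positive term at each step, its positivity coming from the
-- inequality itself.
m<mCj+j : ∀ {m j} → 1 ≤ j → j ≤ m → m < m C j + j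
m<mCj+j {m} {suc zero} _ _ = ≤-reflexive (trans (+-comm 1 m) (cong (_+ 1) (sym (nC1≡n m))))
m<mCj+j {suc m} {suc (suc j)} _ (s≤s j<m) with m≤n⇒m<n∨m≡n j<m
... | inj₂ refl = ≤-reflexive (cong (_+ suc (suc j)) (sym (nCn≡1 (suc (suc j)))))
... | inj₁ j+1<m = subst (λ c → suc m < c + suc (suc j)) (nCk+nC[k+1]≡[n+1]C[k+1] m (suc j))
  (begin-strict
    suc m                                              <⟨ s≤s (m<mCj+j (s≤s z≤n) j+1<m) ⟩
    1 + (m C suc (suc j) + suc (suc j))                ≡⟨ +-assoc 1 (m C suc (suc j)) (suc (suc j)) ⟨
    (1 + m C suc (suc j)) + suc (suc j)                ≤⟨ +-monoˡ-≤ _ (+-monoˡ-≤ _ 1≤mC[j+1]) ⟩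
    (m C suc j + m C suc (suc j)) + suc (suc j)        ∎)
  where
  open ≤-Reasoning
  1≤mC[j+1] : 1 ≤ m C suc j
  1≤mC[j+1] = +-cancelʳ-≤ (suc j) 1 (m C suc j) (≤-trans (s≤s j<m) (m<mCj+j (s≤s z≤n) j<m))

-- Families of subsets on which being equal or disjoint is an equivalence relation

module _ {A : Set} where

  allPairs-unique : {R : A → A → Set} {L : List A} → Unique L →
                    (∀ {x y} → x ∈ˡ L → y ∈ˡ L → x ≢ y → R x y) → AllPairs R L
  allPairs-unique []          rel = []
  allPairs-unique (x∉ ∷ uniq) rel =
    All.tabulate (λ y∈ → rel (here refl) (there y∈) (All.lookup x∉ y∈)) ∷
    allPairs-unique uniq (λ x∈ y∈ → rel (there x∈) (there y∈))

  2≤length : {x y : A} {L : List A} → x ∈ˡ L → y ∈ˡ L → x ≢ y → 2 ≤ length L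
  2≤length {L = _ ∷ []}    (here refl) (here refl) x≢y = contradiction refl x≢y
  2≤length {L = _ ∷ _ ∷ _} _           _           _   = s≤s (s≤s z≤n)

-- No three members induce a path. The condition `p ≢ r` matters: with `p` equal to `r`, any
-- disjoint pair would force `p` to be disjoint from itself.
DisjointUnionOfCliques : List (Subset n) → Set
DisjointUnionOfCliques L =
  ∀ {p q r} → p ∈ˡ L → q ∈ˡ L → r ∈ˡ L → p ≢ r → Disjoint p q → Disjoint q r → Disjoint p r

module _ (2≤k : 2 ≤ k) (k≤n : k ≤ n)
         (bound : ∀ t → 2 ≤ t → t ≤ k → k ^ t * ((n ∸ t) C (k ∸ t)) + t ≤ (n ∸ 1) C (k ∸ 1))
         (L : List (Subset n)) (uniq : Unique L) (sizes : All (λ p → ∣ p ∣ ≡ k) L) where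

  private
    size : ∀ {p} → p ∈ˡ L → ∣ p ∣ ≡ k
    size = All.lookup sizes

  length-intersecting : (∀ {p q} → p ∈ˡ L → q ∈ˡ L → Nonempty (p ∩ q)) →
                        length L ≤ (n ∸ 1) C (k ∸ 1)
  length-intersecting intersecting with Fin.any? (λ x → All.all? (x ∈?_) L)
  ... | yes (x , all-x) =
    atMost-kSubsets-⊇ ⁅ x ⁆ (∣⁅x⁆∣≡1 x) (≤-trans (s≤s z≤n) 2≤k) L uniq
      (All.zipWith (λ (∣p∣ , x∈p) → ∣p∣ , λ {_} → ⁅x⁆⊆p x∈p) (sizes , all-x))
  ... | no no-common = counted L refl
    where
    -- A member p of L and, for each x ∈ p, a member q of L avoiding x: every member of L
    -- contains some pair {x , y} with x ∈ p and y ∈ q.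
    counted : ∀ L′ → L′ ≡ L → length L′ ≤ (n ∸ 1) C (k ∸ 1)
    counted []       _    = z≤n
    counted (p ∷ L′) refl =
      ≤-trans
        (atMost-≡ (trans (cong (_* (k * c)) (size p∈L))
                    (trans (sym (*-assoc k k c)) (cong (λ z → k * z * c) (sym (*-identityʳ k)))))
          (atMost-meets p through-x) L uniq
          (All.tabulate (λ q∈ →
            (size q∈ , All.tabulate (λ r∈ → intersecting r∈ q∈)) , intersecting p∈L q∈)))
        -- This is the hypothesis at `t = 2`.
        (≤-trans (m≤m+n _ 2) (bound 2 ≤-refl 2≤k))
      where
      c = (n ∸ 2) C (k ∸ 2)
      p∈L : p ∈ˡ L
      p∈L = here refl
      through-x : ∀ x → x ∈ p →
                  AtMost (k * c) (λ q → (∣ q ∣ ≡ k × Meets L q) × x ∈ q)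
      through-x x x∈p with find (All.¬All⇒Any¬ (x ∈?_) L (λ all-x → no-common (x , all-x)))
      ... | q , q∈L , x∉q =
        atMost-≡ (cong (_* c) (size q∈L))
          (atMost-⊆ (λ ((∣r∣ , meets) , x∈r) → (∣r∣ , x∈r) , All.lookup meets q∈L)
            (atMost-meets q λ y y∈q →
              atMost-⊆ (λ ((∣r∣ , x∈r) , y∈r) → ∣r∣ , λ {_} → ⁅x⁆∪p⊆q x∈r (⁅x⁆⊆p y∈r))
                (atMost-kSubsets-⊇ (⁅ x ⁆ ∪ ⁅ y ⁆) (pair-size y y∈q) 2≤k)))
        where
        pair-size : ∀ y → y ∈ q → ∣ ⁅ x ⁆ ∪ ⁅ y ⁆ ∣ ≡ 2
        pair-size y y∈q =
          trans (∣⁅x⁆∪p∣ x ⁅ y ⁆ (x∉q ∘ ⁅x⁆⊆p y∈q)) (cong suc (∣⁅x⁆∣≡1 y))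

  private
    nonempty : ∀ {p} → p ∈ˡ L → Nonempty p
    nonempty {p} p∈ = decidable-stable (nonempty? p) λ empty →
      <-irrefl (trans (sym (∣⊥∣≡0 n)) (trans (cong ∣_∣ (sym (Empty-unique empty))) (size p∈)))
        (≤-trans (s≤s z≤n) 2≤k)

    disjoint⇒≢ : ∀ {p q} → p ∈ˡ L → Disjoint p q → p ≢ q
    disjoint⇒≢ {p} p∈ disj refl = disj (subst Nonempty (sym (∩-idem p)) (nonempty p∈))

  length-disjointUnionOfCliques : DisjointUnionOfCliques L → length L ≤ (n ∸ 1) C (k ∸ 1)
  length-disjointUnionOfCliques cliques with Any.any? (λ p → Any.any? (disjoint? p) L) L
  ... | no none =
    length-intersecting λ {p} {q} p∈ q∈ → decidable-stable (nonempty? (p ∩ q))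
      λ disj → All.lookup (All.¬Any⇒All¬ L (All.lookup (All.¬Any⇒All¬ L none) p∈)) q∈ disj
  ... | yes some with find some
  ... | p , p∈L , some′ with find some′
  ... | q , q∈L , p-q = ≤-trans (≤-reflexive (length-filter-∁ inClique? L)) both
    where
    -- The class of `p` under "equal or disjoint". `T` is this clique, with at least the two members
    -- `p` and `q`, and `R` is the rest of `L`.
    InClique : Subset n → Set
    InClique r = r ≡ p ⊎ Disjoint r p

    inClique? : Decidable InClique
    inClique? r = ≡-dec _≟ᵇ_ r p ⊎-dec disjoint? r p

    T R : List (Subset n)
    T = filter inClique? L
    R = filter (¬? ∘ inClique?) L

    disjoint-within : ∀ {r s} → r ∈ˡ T → s ∈ˡ T → r ≢ s → Disjoint r s
    disjoint-within r∈ s∈ r≢s with ∈-filter⁻ inClique? {xs = L} r∈ | ∈-filter⁻ inClique? {xs = L} s∈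
    ... | _   , inj₁ refl | _   , inj₁ refl = contradiction refl r≢s
    ... | _   , inj₁ refl | _   , inj₂ s-p  = disjoint-sym s-p
    ... | _   , inj₂ r-p  | _   , inj₁ refl = r-p
    ... | r∈L , inj₂ r-p  | s∈L , inj₂ s-p  = cliques r∈L p∈L s∈L r≢s r-p (disjoint-sym s-p)

    T-disjoint : AllPairs Disjoint T
    T-disjoint = allPairs-unique (Unique.filter⁺ inClique? uniq) disjoint-within

    T-sizes : All (λ r → ∣ r ∣ ≡ k) T
    T-sizes = All.filter⁺ inClique? sizes

    2≤∣T∣ : 2 ≤ length T
    2≤∣T∣ = 2≤length (∈-filter⁺ inClique? p∈L (inj₁ refl))
                     (∈-filter⁺ inClique? q∈L (inj₂ (disjoint-sym p-q)))
                     (disjoint⇒≢ p∈L p-q)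

    -- If `r` were disjoint from some `s` in the clique of `p`, transitivity through `s` would put
    -- `r` in that clique as well.
    meets : ∀ {r s} → r ∈ˡ R → s ∈ˡ T → Nonempty (s ∩ r)
    meets {r} {s} r∈ s∈ = decidable-stable (nonempty? (s ∩ r)) absurd
      where
      absurd : ¬ Disjoint s r
      absurd s-r with ∈-filter⁻ (¬? ∘ inClique?) {xs = L} r∈ | ∈-filter⁻ inClique? {xs = L} s∈
      ... | r∈L , r∉T | s∈L , inj₁ refl = r∉T (inj₂ (disjoint-sym s-r))
      ... | r∈L , r∉T | s∈L , inj₂ s-p  =
        r∉T (inj₂ (cliques r∈L s∈L p∈L (r∉T ∘ inj₁) (disjoint-sym s-r) s-p))

    R-meets : All (λ r → Meets T r) R
    R-meets = All.tabulate λ r∈ → All.tabulate (meets r∈)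

    R-sizes : All (λ r → ∣ r ∣ ≡ k) R
    R-sizes = All.filter⁺ (¬? ∘ inClique?) sizes

    ∣T∣*k≤n : length T * k ≤ n
    ∣T∣*k≤n = ≤-trans
      (length*m≤∣q∣ T ⊤ T-disjoint
        (All.map (λ {r} ∣r∣ → ≤-reflexive (trans (sym ∣r∣) (cong ∣_∣ (sym (∩-identityʳ r))))) T-sizes))
      (≤-reflexive (∣⊤∣≡n n))

    -- More than k pairwise disjoint sets cannot all meet a k-set.
    R-empty : k < length T → ∀ R → All (λ r → Meets T r) R → All (λ r → ∣ r ∣ ≡ k) R → length R ≡ 0
    R-empty k<∣T∣ []      _             _         = refl
    R-empty k<∣T∣ (r ∷ _) (r-meets ∷ _) (∣r∣ ∷ _) =
      contradiction
        (begin-strict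
          k            <⟨ k<∣T∣ ⟩
          length T     ≡⟨ *-identityʳ (length T) ⟨
          length T * 1 ≤⟨ length*m≤∣q∣ T r T-disjoint (All.map 1≤ r-meets) ⟩
          ∣ r ∣        ≡⟨ ∣r∣ ⟩
          k            ∎)
        (<-irrefl refl)
      where
      open ≤-Reasoning
      1≤ : ∀ {s} → Nonempty (s ∩ r) → 1 ≤ ∣ s ∩ r ∣
      1≤ {s} (x , x∈) = subst (_≤ ∣ s ∩ r ∣) (∣⁅x⁆∣≡1 x)
        (p⊆q⇒∣p∣≤∣q∣ λ y∈ → subst (_∈ s ∩ r) (sym (x∈⁅y⁆⇒x≡y x y∈)) x∈)

    both : length T + length R ≤ (n ∸ 1) C (k ∸ 1)
    both with length T ≤? k
    ... | yes ∣T∣≤k = begin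
      length T + length R
        ≤⟨ +-monoʳ-≤ (length T)
             -- Starting with no prescribed points makes `t` equal to `length T`.
             (atMost-transversal T ⊥ T-disjoint T-sizes
               (All.tabulate λ _ (x , x∈) → ∉⊥ (proj₁ (x∈p∩q⁻ ⊥ _ x∈)))
               (trans (cong (length T +_) (∣⊥∣≡0 n)) (+-identityʳ (length T))) ∣T∣≤k
               R (Unique.filter⁺ (¬? ∘ inClique?) uniq)
               (All.zipWith (λ (∣r∣ , m) → (∣r∣ , λ {_} → ⊥⊆) , m) (R-sizes , R-meets))) ⟩
      length T + k ^ length T * ((n ∸ length T) C (k ∸ length T))
        ≡⟨ +-comm (length T) _ ⟩
      k ^ length T * ((n ∸ length T) C (k ∸ length T)) + length T
        ≤⟨ bound (length T) 2≤∣T∣ ∣T∣≤k ⟩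
      (n ∸ 1) C (k ∸ 1) ∎
      where open ≤-Reasoning
    ... | no ∣T∣≰k = begin
      length T + length R ≡⟨ cong (length T +_) (R-empty k<∣T∣ R R-meets R-sizes) ⟩
      length T + 0        ≡⟨ +-identityʳ _ ⟩
      length T            ≤⟨ +-cancelʳ-≤ (length T) _ _ twice ⟩
      (n ∸ 1) C (k ∸ 1)   ∎
      where
      open ≤-Reasoning
      k<∣T∣ = ≰⇒> ∣T∣≰k
      1≤k = ≤-trans (s≤s z≤n) 2≤k
      -- Since `k` is at least 2, twice the size of `T` is at most `n`, hence at most the binomial
      -- plus `k ∸ 1`; as `k` is below `length T`, one copy of `length T` cancels.
      twice : length T + length T ≤ (n ∸ 1) C (k ∸ 1) + length T
      twice = begin
        length T + length T              ≡⟨ cong (length T +_) (+-identityʳ (length T)) ⟨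
        2 * length T                     ≡⟨ *-comm 2 (length T) ⟩
        length T * 2                     ≤⟨ *-monoʳ-≤ (length T) 2≤k ⟩
        length T * k                     ≤⟨ ∣T∣*k≤n ⟩
        n                                ≡⟨ m+[n∸m]≡n (≤-trans 1≤k k≤n) ⟨
        1 + (n ∸ 1)                      ≤⟨ m<mCj+j (∸-monoˡ-≤ 1 2≤k) (∸-monoˡ-≤ 1 k≤n) ⟩
        (n ∸ 1) C (k ∸ 1) + (k ∸ 1)      ≤⟨ +-monoʳ-≤ ((n ∸ 1) C (k ∸ 1)) (≤-trans (m∸n≤m k 1) (<⇒≤ k<∣T∣)) ⟩
        (n ∸ 1) C (k ∸ 1) + length T     ∎

-- General position sets of Kneser graphs

kSubset-≡ : {a b : KSubset n k} → proj₁ a ≡ proj₁ b → a ≡ b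
kSubset-≡ {a = p , e} {.p , e′} refl = cong (p ,_) (≡-irrelevant e e′)

length-kSubsets : ∀ n k → length (kSubsets n k) ≡ n C k
length-kSubsets zero    zero    = refl
length-kSubsets zero    (suc k) = refl
length-kSubsets (suc n) zero    =
  trans (length-map _ (kSubsets n zero)) (length-kSubsets n zero)
length-kSubsets (suc n) (suc k) =
  trans (length-++ (map _ (kSubsets n k)))
    (trans (cong₂ _+_ (trans (length-map _ (kSubsets n k)) (length-kSubsets n k))
                      (trans (length-map _ (kSubsets n (suc k))) (length-kSubsets n (suc k))))
      (nCk+nC[k+1]≡[n+1]C[k+1] n k))

unique-kSubsets : ∀ n k → Unique (kSubsets n k)
unique-kSubsets zero    zero    = [] ∷ []
unique-kSubsets zero    (suc k) = []
unique-kSubsets (suc n) zero    =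
  Unique.map⁺ (kSubset-≡ ∘ cong (tail ∘ proj₁)) (unique-kSubsets n zero)
unique-kSubsets (suc n) (suc k) =
  Unique.++⁺ (Unique.map⁺ (kSubset-≡ ∘ cong (tail ∘ proj₁)) (unique-kSubsets n k))
             (Unique.map⁺ (kSubset-≡ ∘ cong (tail ∘ proj₁)) (unique-kSubsets n (suc k)))
             heads-differ
  where
  heads-differ : ∀ {v} → ¬ (v ∈ˡ map _ (kSubsets n k) × v ∈ˡ map _ (kSubsets n (suc k)))
  heads-differ (v∈in , v∈out) with ∈-map⁻ _ v∈in | ∈-map⁻ _ v∈out
  ... | _ , _ , v≡in | _ , _ , v≡out
    with cong (head ∘ proj₁) (trans (sym v≡in) v≡out)
  ... | ()

subset-of-size : ∀ k (p : Subset n) → k ≤ ∣ p ∣ → ∃ λ q → ∣ q ∣ ≡ k × q ⊆ p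
subset-of-size {n} zero p _ = ⊥ , ∣⊥∣≡0 n , ⊆-min p
subset-of-size (suc k) (inside ∷ p) (s≤s k≤) with subset-of-size k p k≤
... | q , ∣q∣ , q⊆p = inside ∷ q , cong suc ∣q∣ , in⊆in q⊆p
subset-of-size (suc k) (outside ∷ p) k≤ with subset-of-size (suc k) p k≤
... | q , ∣q∣ , q⊆p = outside ∷ q , ∣q∣ , out⊆ q⊆p

-- The star of a point as a general position set

cone : KSubset n k → KSubset (suc n) (suc k)
cone (p , e) = inside ∷ p , cong suc e

-- The extremal family: all sets through the point `zero`, each determined by its `k` other points
-- among the remaining `n`, which gives the size `n C k`.
star : ∀ n k → List (KSubset (suc n) (suc k))
star n k = map cone (kSubsets n k)

-- Apart from `zero`, the two cones cover at most `k + k` of the `n` points, so `suc k` points are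
-- left for a set that also avoids `zero`.
common-neighbour : k + (k + suc k) ≤ n → (a b : KSubset n k) →
                   ∃ λ (c : KSubset (suc n) (suc k)) →
                     Disjoint (proj₁ (cone a)) (proj₁ c) × Disjoint (proj₁ c) (proj₁ (cone b))
common-neighbour {k} {n} large (p , ∣p∣) (q , ∣q∣)
  with subset-of-size (suc k) (∁ (p ∪ q)) room
  where
  room : suc k ≤ ∣ ∁ (p ∪ q) ∣
  room = begin
    suc k                         ≡⟨ m+n∸m≡n (k + k) (suc k) ⟨
    (k + k) + suc k ∸ (k + k)     ≡⟨ cong (_∸ (k + k)) (+-assoc k k (suc k)) ⟩
    k + (k + suc k) ∸ (k + k)     ≤⟨ ∸-mono large union≤ ⟩
    n ∸ ∣ p ∪ q ∣                 ≡⟨ ∣∁p∣≡n∸∣p∣ (p ∪ q) ⟨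
    ∣ ∁ (p ∪ q) ∣                 ∎
    where
    open ≤-Reasoning
    union≤ : ∣ p ∪ q ∣ ≤ k + k
    union≤ = ≤-trans (∣p∪q∣≤∣p∣+∣q∣ p q) (≤-reflexive (cong₂ _+_ ∣p∣ ∣q∣))
... | r , ∣r∣ , r⊆ = (outside ∷ r , ∣r∣) , p-r , r-q
  where
  p-r : Disjoint (inside ∷ p) (outside ∷ r)
  p-r (suc x , there x∈) with x∈p∩q⁻ p r x∈
  ... | x∈p , x∈r = x∈∁p⇒x∉p (r⊆ x∈r) (x∈p∪q⁺ (inj₁ x∈p))
  r-q : Disjoint (outside ∷ r) (inside ∷ q)
  r-q (suc x , there x∈) with x∈p∩q⁻ r q x∈
  ... | x∈r , x∈q = x∈∁p⇒x∉p (r⊆ x∈r) (x∈p∪q⁺ (inj₂ x∈q))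

adjacent⇒≢ : .{{_ : NonZero k}} {a b : KSubset n k} → Disjoint (proj₁ a) (proj₁ b) → a ≢ b
adjacent⇒≢ {k} {n} {a} a-b refl = Graph.irreflexive (Kneser n k) {a} refl a-b

-- Any two members share `zero`, so the star is independent: the inner vertex of a walk of length
-- two is not a member. Longer walks between distinct members are not geodesics, as a common
-- neighbour gives distance two.
star-generalPosition : k + (k + suc k) ≤ n →
                       IsGeneralPositionSet (Kneser (suc n) (suc k)) (star n k)
star-generalPosition {k} {n} large = record
  { unique          = Unique.map⁺ (kSubset-≡ ∘ cong (tail ∘ proj₁)) (unique-kSubsets n k)
  ; generalPosition = λ {u} {v} {w} → general {u} {v} {w}
  }
  where
  G = Kneser (suc n) (suc k)

  nonadjacent : ∀ {u v} → u ∈ˡ star n k → v ∈ˡ star n k → ¬ Graph.Adj G u v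
  nonadjacent u∈ v∈ u-v with ∈-map⁻ cone u∈ | ∈-map⁻ cone v∈
  ... | _ , _ , refl | _ , _ , refl = u-v (zero , here)

  general : ∀ {u v w} → u ∈ˡ star n k → v ∈ˡ star n k → w ∈ˡ star n k →
            u ≢ v → w ≢ u → w ≢ v → (p : Walk G u v) → IsGeodesic G p → w ∉ˡ walkVertices G p
  general u∈ v∈ w∈ u≢v w≢u w≢v ε _ _ = u≢v refl
  general u∈ v∈ w∈ u≢v w≢u w≢v (u-v ◅ ε) _ _ = nonadjacent u∈ v∈ u-v
  general u∈ v∈ w∈ u≢v w≢u w≢v (_ ◅ _ ◅ ε) _ (here w≡u) = w≢u w≡u
  general u∈ v∈ w∈ u≢v w≢u w≢v (u-x ◅ _ ◅ ε) _ (there (here refl)) = nonadjacent u∈ w∈ u-x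
  general u∈ v∈ w∈ u≢v w≢u w≢v (_ ◅ _ ◅ ε) _ (there (there (here w≡v))) = w≢v w≡v
  general u∈ v∈ w∈ u≢v w≢u w≢v (_ ◅ _ ◅ _ ◅ _) (_ , _ , shortest) _
    with ∈-map⁻ cone u∈ | ∈-map⁻ cone v∈
  ... | a , _ , refl | b , _ , refl with common-neighbour large a b
  ... | c , a-c , c-b
    -- The path through `c` has length two, against a supposed geodesic of length at least three.
    with shortest (_◅_ {j = c} a-c (c-b ◅ ε))
           ((adjacent⇒≢ {a = cone a} {c} a-c ∷ u≢v ∷ []) ∷
            (adjacent⇒≢ {a = c} {cone b} c-b ∷ []) ∷ [] ∷ [])
  ... | s≤s (s≤s ())

-- Non-adjacent vertices with a common neighbour are at distance 2, so a general position set
-- induces no path on three vertices.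
generalPosition⇒cliques :
  .{{_ : NonZero k}} (S : List (KSubset n k)) → IsGeneralPositionSet (Kneser n k) S →
  DisjointUnionOfCliques (map proj₁ S)
generalPosition⇒cliques {k} {n} S gp p∈ q∈ r∈ p≢r p-q q-r
  with ∈-map⁻ proj₁ p∈ | ∈-map⁻ proj₁ q∈ | ∈-map⁻ proj₁ r∈
... | u , u∈ , refl | v , v∈ , refl | w , w∈ , refl =
  decidable-stable (disjoint? (proj₁ u) (proj₁ w)) λ not-adjacent →
    IsGeneralPositionSet.generalPosition gp u∈ w∈ v∈ u≢w (≢-sym u≢v) v≢w
      walk (path , (walk , path , refl) , shortest not-adjacent) (there (here refl))
  where
  G = Kneser n k
  u≢v : u ≢ v
  u≢v = adjacent⇒≢ {a = u} {v} p-q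
  v≢w : v ≢ w
  v≢w = adjacent⇒≢ {a = v} {w} q-r
  u≢w : u ≢ w
  u≢w = p≢r ∘ cong proj₁
  walk : Walk G u w
  walk = _◅_ {j = v} p-q (q-r ◅ ε)
  path : IsPath G walk
  path = (u≢v ∷ u≢w ∷ []) ∷ (v≢w ∷ []) ∷ [] ∷ []
  shortest : ¬ Graph.Adj G u w → (p : Walk G u w) → IsPath G p → 2 ≤ walkLength G p
  shortest not-adjacent ε           _ = contradiction refl u≢w
  shortest not-adjacent (u-w ◅ ε)   _ = contradiction u-w not-adjacent
  shortest not-adjacent (_ ◅ _ ◅ _) _ = s≤s (s≤s z≤n)

-- At `k = 1` the range of `t` is empty and the binomial is 1, while the graph is complete and has
-- general position number `n`; hence the condition `k ≥ 2`.
theorem2p3 : (n k : ℕ) → .{{_ : NonZero k}} →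
    k ≥ 2 →
    n ≥ 3 * k ∸ 1 →
    (∀ t → 2 ≤ t → t ≤ k →
    k ^ t * ((n ∸ t) C (k ∸ t)) + t ≤ (n ∸ 1) C (k ∸ 1)) →
    IsGpNumber (Kneser n k) ((n ∸ 1) C (k ∸ 1))
theorem2p3 zero    (suc k) _   n≥ _ with m+n≤o⇒n≤o k n≥
... | ()
theorem2p3 (suc n) (suc k) 2≤k n≥ bound =
    (star n k , star-generalPosition large
      , trans (length-map cone (kSubsets n k)) (length-kSubsets n k))
  , λ S gp →
      subst (_≤ n C k) (length-map proj₁ S)
        (length-disjointUnionOfCliques 2≤k (m+n≤o⇒m≤o _ (m+n≤o⇒n≤o k n≥)) bound (map proj₁ S)
          (Unique.map⁺ kSubset-≡ (IsGeneralPositionSet.unique gp))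
          (All.map⁺ (All.tabulate λ {a} _ → proj₂ a))
          (generalPosition⇒cliques S gp))
  where
  -- With `n` and `k` standing for one less than the parameters, `3 * suc k ∸ 1` unfolds to
  -- `k + (suc k + (suc k + 0))`; one successor is cancelled on each side.
  large : k + (k + suc k) ≤ n
  large = ≤-pred (subst (_≤ suc n)
    (trans (cong (λ z → k + (suc k + suc z)) (+-identityʳ k)) (+-suc k (k + suc k))) n≥)
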